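{- There exists a finite simple undirected graph $G$ on $33$ vertices and $66$ edges such that (1) $G$ is $4$-regular, triangle-free, of girth four, and four-vertex-connected; (2) $\kappa_2(G)=\kappa(G)=1$; (3) no four-vertex-connected ordinary subgraph of $G$ admits a legal system.
   Context: All graphs are finite, simple and undirected. $V(H)$, $E(H)$ denote the vertex set and edge set of $H$; $H-U$ is the graph obtained by deleting the vertex set $U$ and all incident edges; $H[T]$ is the subgraph induced on $T$. A one-vertex graph is connected; the empty graph is not connected. Ordinary subgraph: an ordinary subgraph of $G$ is a graph $H$ with $V(H)\subseteq V(G)$ and $E(H)\subseteq\{e\in E(G):\text{both ends of } e \text{ lie in } V(H)\}$; it need not be induced. Four-vertex-connected: $H$ is four-vertex-connected if $|V(H)|\ge 5$ and $H-U$ is connected for every $U\subseteq V(H)$ with $|U|\le 3$. Legal systems: subsets of $V(H)$ are identified with vectors in $\mathbb{F}_2^{V(H)}$ via characteristic vectors, so symmetric difference is vector addition. A move at a vertex $v$ of $H$ is a subset $m\subseteq V(H)$ such that $v\in m$ and $m$ contains no neighbour of $v$. A state $T\subseteq V(H)$ is legal if the induced subgraphs $H[T]$ and $H[V(H)\setminus T]$ are both nonempty and connected. A legal system for $H$ is a choice of a move $m_v$ at each vertex $v$ together with a state $S\subseteq V(H)$ such that every element of the coset $S+\operatorname{span}_{\mathbb{F}_2}\{m_v:v\in V(H)\}$ is a legal state. Curvature: $\kappa_2(H)=1-\frac{|V(H)|}{2}+\frac{|E(H)|}{4}$. The Charney--Davis curvature is $\kappa(H)=\sum_{i\ge 0}(-2)^{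 -i}c_i(H)$, where $c_i(H)$ is the number of cliques of $H$ with exactly $i$ vertices and $c_0(H)=1$. -}

module Defs where

open import Data.Bool using (_xor_)
open import Data.Fin using (Fin; zero; suc; inject₁; fromℕ; toℕ)
open import Data.Fin.Properties using (_≟_; _<?_; all?)
open import Data.Fin.Subset
  using (Subset; inside; outside; ⊥; _∈_; _∉_; _⊆_; Nonempty; ∁; _∩_; ∣_∣)
open import Data.Fin.Subset.Properties using (_∈?_; _⊆?_; x∈p∩q⁺)
open import Data.Integer using (+_)
open import Data.List as List using (List; []; _∷_; _++_; allFin; cartesianProduct; filter; length)
open import Data.Nat using (ℕ; zero; suc; _≤_)
open import Data.Product using (_×_; _,_; ∃-syntax)
open import Data.Rational using (ℚ; 1ℚ; -½; _/_; _+_; _-_; _*_; +-*-rawSemiring)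
open import Data.Vec as Vec using (tabulate; zipWith)
open import Function.Definitions using (Injective)
open import Relation.Binary.Construct.Closure.ReflexiveTransitive using (Star)
open import Relation.Binary.Definitions using (Decidable; Symmetric)
open import Relation.Binary.PropositionalEquality using (_≡_; _≢_)
open import Relation.Nullary using (¬_; Dec; does; ¬?; _×-dec_; _→-dec_)

open import Algebra.Definitions.RawSemiring +-*-rawSemiring using (_^_; sum)

private
  variable
    n : ℕ

-- A finite simple graph whose vertex set is a subset of the ambient label
-- set Fin n, so that a graph and its subgraphs share one type.
record Graph (n : ℕ) : Set₁ where
  field
    V      : Subset n
    Adj    : Fin n → Fin n → Set
    Adj?   : Decidable Adj
    sym    : Symmetric Adj
    irrefl : ∀ {v} → ¬ Adj v v
    -- By symmetry the other end lies in V as well.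
    end∈V  : ∀ {u v} → Adj u v → u ∈ V

open Graph public

order : Graph n → ℕ
order H = ∣ V H ∣

-- Each edge is listed once, as the pair of its ends in increasing order.
edges : Graph n → List (Fin n × Fin n)
edges {n} H =
  filter (λ { (u , v) → (u <? v) ×-dec Adj? H u v })
         (cartesianProduct (allFin n) (allFin n))

size : Graph n → ℕ
size H = length (edges H)

_[_] : Graph n → Subset n → Graph n
V      (H [ T ])     = V H ∩ T
Adj    (H [ T ]) u v = Adj H u v × u ∈ T × v ∈ T
Adj?   (H [ T ]) u v = Adj? H u v ×-dec (u ∈? T) ×-dec (v ∈? T)
sym    (H [ T ]) (e , u∈T , v∈T) = sym H e , v∈T , u∈T
irrefl (H [ T ]) (e , _) = irrefl H e
end∈V  (H [ T ]) (e , u∈T , _) = x∈p∩q⁺ (end∈V H e , u∈T)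

_∖_ : Graph n → Subset n → Graph n
H ∖ U = H [ ∁ U ]

-- Ordinary (not necessarily induced) subgraphs.
_⊑_ : Graph n → Graph n → Set
H ⊑ G = V H ⊆ V G × (∀ {u v} → Adj H u v → Adj G u v)

Connected : Graph n → Set
Connected H = Nonempty (V H) × (∀ {u v} → u ∈ V H → v ∈ V H → Star (Adj H) u v)

FourVertexConnected : Graph n → Set
FourVertexConnected {n} H =
  5 ≤ order H × (∀ (U : Subset n) → U ⊆ V H → ∣ U ∣ ≤ 3 → Connected (H ∖ U))

degree : Graph n → Fin n → ℕ
degree H v = ∣ tabulate (λ w → does (Adj? H v w)) ∣

Regular : ℕ → Graph n → Set
Regular d H = ∀ {v} → v ∈ V H → degree H v ≡ d

TriangleFree : Graph n → Set
TriangleFree H = ∀ {u v w} → ¬ (Adj H u v × Adj H v w × Adj H u w)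

-- A cycle c 0, c 1, …, c m (of length suc m ≥ 3), closed by the edge from c m to c 0.
IsCycle : Graph n → ∀ {m} → (Fin (suc m) → Fin n) → Set
IsCycle H {m} c =
    2 ≤ m
  × Injective _≡_ _≡_ c
  × (∀ (i : Fin m) → Adj H (c (inject₁ i)) (c (suc i)))
  × Adj H (c (fromℕ m)) (c zero)

Girth : Graph n → ℕ → Set
Girth {n} H g =
    (∃[ m ] g ≡ suc m × (∃[ c ] IsCycle H {m} c))
  × (∀ {m} (c : Fin (suc m) → Fin n) → IsCycle H c → g ≤ suc m)

IsClique : Graph n → Subset n → Set
IsClique H K = K ⊆ V H × (∀ u v → u ∈ K → v ∈ K → u ≢ v → Adj H u v)

isClique? : (H : Graph n) (K : Subset n) → Dec (IsClique H K)
isClique? H K =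
  (K ⊆? V H) ×-dec
  all? (λ u → all? (λ v →
    (u ∈? K) →-dec (v ∈? K) →-dec ¬? (u ≟ v) →-dec Adj? H u v))

-- All k-element subsets of Fin n, each listed exactly once.
subsetsOfSize : ∀ n → ℕ → List (Subset n)
subsetsOfSize zero    zero    = Vec.[] ∷ []
subsetsOfSize zero    (suc k) = []
subsetsOfSize (suc n) zero    = ⊥ ∷ []
subsetsOfSize (suc n) (suc k) =
     List.map (inside  Vec.∷_) (subsetsOfSize n k)
  ++ List.map (outside Vec.∷_) (subsetsOfSize n (suc k))

cliqueCount : Graph n → ℕ → ℕ
cliqueCount {n} H i = length (filter (isClique? H) (subsetsOfSize n i))

κ₂ : Graph n → ℚ
κ₂ H = 1ℚ - (+ order H) / 2 + (+ size H) / 4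

-- The sum over all i ≥ 0 stops at i = |V(H)|: larger cliques do not exist.
κ : Graph n → ℚ
κ H = sum {suc (order H)} (λ i → -½ ^ toℕ i * ((+ cliqueCount H (toℕ i)) / 1))

infixl 6 _⊕_

-- Symmetric difference, i.e. addition of characteristic vectors over 𝔽₂.
_⊕_ : Subset n → Subset n → Subset n
_⊕_ = zipWith _xor_

-- The 𝔽₂-span of the vectors m v with v ∈ B.  Closure under scalars is
-- automatic, the only scalars being 0 and 1.
data Span (B : Subset n) (m : Fin n → Subset n) : Subset n → Set where
  0∈  : Span B m ⊥
  gen : ∀ {v} → v ∈ B → Span B m (m v)
  add : ∀ {x y} → Span B m x → Span B m y → Span B m (x ⊕ y)

IsMove : Graph n → Fin n → Subset n → Set
IsMove H v m = m ⊆ V H × v ∈ m × (∀ {w} → Adj H v w → w ∉ m)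

-- Connected includes nonemptiness, and V (H ∖ T) = V H ∖ T.
IsLegal : Graph n → Subset n → Set
IsLegal H T = T ⊆ V H × Connected (H [ T ]) × Connected (H ∖ T)

-- Values of move at labels outside V H play no role.
record LegalSystem (H : Graph n) : Set where
  field
    move   : Fin n → Subset n
    isMove : ∀ {v} → v ∈ V H → IsMove H v (move v)
    state  : Subset n
    state⊆ : state ⊆ V H
    legal  : ∀ {x} → Span (V H) move x → IsLegal H (state ⊕ x)

{-# OPTIONS --safe #-}

-- A four-vertex-connected subgraph has minimum degree at least four, so in a connected 4-regular
-- graph it is the whole graph; hence only G itself has to be shown to have no legal system.
-- The move at u changes the colour of u but of no neighbour of u, so an edge is monochromatic in
-- exactly half of the states of a legal system.  In every state, both colours occur among the
-- four common neighbours of the three twins of a K₃,₄ in G.  Contracting the two colour classes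
-- of each of the four disjoint copies of K₃,₄ leaves 4 · 2 + 5 = 13 cells, joined by the 18 edges
-- of G outside the copies.  As both colour classes of G are connected, at least 13 − 2 = 11 of
-- these 18 edges are monochromatic in every state, although on average only 9 are.

module Submission where

open import Defs
open import Data.Bool using (Bool; true; false; T; not; if_then_else_; _∧_; _∨_; _xor_)
import Data.Bool.Properties as Bool
open import Data.Fin using (Fin; zero; suc; toℕ; inject₁; #_; _↑ˡ_; _↑ʳ_; splitAt; combine; remQuot; punchIn; punchOut)
open import Data.Fin.Properties
  using (_≟_; all?; any?; punchOut-punchIn; punchInᵢ≢i; punchOut-cong; splitAt⁻¹-↑ˡ; splitAt⁻¹-↑ʳ)
open import Data.Fin.Subset
  using (Subset; inside; outside; Nonempty; ⊤; ⊥; ⁅_⁆; _∈_; _∉_; _⊆_; ∁; _∩_; _-_; ∣_∣)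
open import Data.Fin.Subset.Properties
import Data.Integer as ℤ
open import Data.List as List using (List; []; _∷_; _++_; length; allFin; tabulate; concatMap)
open import Data.List.Membership.Propositional using (find) renaming (_∈_ to _∈ˡ_)
import Data.List.Membership.DecPropositional as DecMembership
open import Data.List.Membership.Propositional.Properties using (∈-tabulate⁻)
open import Data.List.Properties using (filter-none)
open import Data.List.Relation.Unary.All as All using (All; []; _∷_)
import Data.List.Relation.Unary.All.Properties as All
open import Data.List.Relation.Unary.AllPairs using (AllPairs; _∷_; allPairs?)
open import Data.List.Relation.Unary.Any using (here; there)
open import Data.List.Relation.Unary.Linked using (Linked; [-]; _∷_; linked?)
open import Data.Nat using (ℕ; zero; suc; _≤_; _<_; _+_; _*_; _^_; z≤n; s≤s; s≤s⁻¹)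
import Data.Nat as ℕ
import Data.Nat.Properties as ℕ
open import Algebra.Properties.CommutativeSemigroup ℕ.+-commutativeSemigroup using (interchange)
open import Data.Nat.Solver using (module +-*-Solver)
open import Data.Product using (_×_; _,_; proj₁; proj₂; ∃-syntax)
open import Data.Product.Properties using (≡-dec)
open import Data.Rational using (ℚ; 0ℚ; 1ℚ; -½; _/_; +-*-rawSemiring)
  renaming (_+_ to _+ℚ_; _-_ to _-ℚ_; _*_ to _*ℚ_)
open import Algebra.Definitions.RawSemiring +-*-rawSemiring using (sum) renaming (_^_ to _^ℚ_)
import Data.Rational.Properties as ℚ
open import Data.Sum as Sum using (_⊎_; inj₁; inj₂; [_,_]′)
import Data.Sum.Properties as Sum
open import Data.Vec as Vec using ([]; _∷_; lookup; _[_]%=_)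
open import Data.Vec.Properties using (lookup∘tabulate; lookup⇒[]=; []=⇒lookup; lookup-zipWith)
open import Function using (_∘_; const; case_of_)
open import Relation.Binary.Construct.Closure.ReflexiveTransitive as Star
  using (Star; ε; _◅_; _◅◅_)
open import Relation.Binary.PropositionalEquality
  using (_≡_; _≢_; refl; cong; cong₂; subst; trans; module ≡-Reasoning) renaming (sym to ≡-sym)
open import Relation.Nullary
open import Relation.Nullary.Decidable using (dec-true)
open import Relation.Unary using (Decidable)

private
  variable
    n k : ℕ

-- Connectivity from systems of disjoint paths

module _ {n : ℕ} where

  PairwiseDisjoint : List (List (Fin n)) → Set
  PairwiseDisjoint = AllPairs (λ p q → All (λ x → All (x ≢_) q) p)

  pairwiseDisjoint? : ∀ ps → Dec (PairwiseDisjoint ps)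
  pairwiseDisjoint? = allPairs? λ p q → All.all? (λ x → All.all? (λ y → ¬? (x ≟ y)) q) p

  -- If `U` meets the first list at `x`, then by disjointness `x` lies on no later list. The search
  -- therefore continues with `U - x`, which is smaller than `U`.
  missed-list : ∀ {ps} {U : Subset n} → PairwiseDisjoint ps → ∣ U ∣ < length ps →
                ∃[ p ] p ∈ˡ ps × All (_∉ U) p
  missed-list {p ∷ ps} {U} (p# ∷ ps#) U<ps with All.all? (λ x → ¬? (x ∈? U)) p
  ... | yes p∉U = p , here refl , p∉U
  ... | no ¬p∉U with find (All.¬All⇒Any¬ (λ x → ¬? (x ∈? U)) p ¬p∉U)
  ...   | x , x∈p , ¬x∉U with decidable-stable (x ∈? U) ¬x∉U
  ...     | x∈U with missed-list {ps} {U - x} ps# (ℕ.<-≤-trans (x∈p⇒∣p-x∣<∣p∣ x∈U) (s≤s⁻¹ U<ps))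
  ...       | q , q∈ps , q∉U-x = q , there q∈ps , All.tabulate λ {y} y∈q y∈U →
              All.lookup q∉U-x y∈q (x∈p∧x≢y⇒x∈p-y y∈U
                (All.lookup (All.lookup (All.lookup p# q∈ps) x∈p) y∈q ∘ ≡-sym))

  terminus : Fin n → List (Fin n) → Fin n
  terminus v []      = v
  terminus v (x ∷ p) = terminus x p

  walk-avoiding : ∀ (H : Graph n) {U v p} → v ∉ U → All (_∉ U) p → Linked (Adj H) (v ∷ p) →
                  terminus v p ∉ U × Star (Adj (H ∖ U)) v (terminus v p)
  walk-avoiding H v∉U [] [-] = v∉U , ε
  walk-avoiding H v∉U (x∉U ∷ p∉U) (e ∷ es) with walk-avoiding H x∉U p∉U es
  ... | t∉U , w = t∉U , (e , x∉p⇒x∈∁p v∉U , x∉p⇒x∈∁p x∉U) ◅ w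

  -- The paths are listed without their common start `v`, so that they can be pairwise disjoint. An
  -- empty list stands for the trivial path ending at `v` itself.
  IsFan : Graph n → (Fin n → Set) → Fin n → List (List (Fin n)) → Set
  IsFan H Target v ps =
    3 < length ps × PairwiseDisjoint ps ×
    All (λ p → Linked (Adj H) (v ∷ p) × Target (terminus v p)) ps

  isFan? : ∀ (H : Graph n) {Target : Fin n → Set} → Decidable Target →
           ∀ v ps → Dec (IsFan H Target v ps)
  isFan? H target? v ps =
    (3 ℕ.<? length ps) ×-dec pairwiseDisjoint? ps ×-dec
    All.all? (λ p → linked? (Adj? H) (v ∷ p) ×-dec target? (terminus v p)) ps

  -- The easy direction of Menger's theorem: at most three deleted vertices cannot meet all of at
  -- least four disjoint paths.
  fan-survives : ∀ (H : Graph n) (Target : Fin n → Set) {U v} ps →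
    IsFan H Target v ps → ∣ U ∣ ≤ 3 → v ∉ U →
    ∃[ t ] Target t × t ∉ U × Star (Adj (H ∖ U)) v t
  fan-survives H Target {v = v} ps (3<ps , disjoint , valid) U≤3 v∉U
    with missed-list disjoint (ℕ.≤-<-trans U≤3 3<ps)
  ... | p , p∈ps , p∉U with All.lookup valid p∈ps
  ...   | linked , target = terminus v p , target , walk-avoiding H v∉U p∉U linked

reverse-walk : ∀ (H : Graph n) {u v} → Star (Adj H) u v → Star (Adj H) v u
reverse-walk H = Star.reverse (sym H)

-- Four-vertex-connected subgraphs of a 4-regular graph

∣p∣≤1+∣p-x∣ : ∀ (p : Subset n) x → ∣ p ∣ ≤ suc ∣ p - x ∣
∣p∣≤1+∣p-x∣ (inside  ∷ p) zero    = s≤s (ℕ.≤-reflexive (cong ∣_∣ (≡-sym (p─⊥≡p p))))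
∣p∣≤1+∣p-x∣ (outside ∷ p) zero    = ℕ.m≤n⇒m≤1+n (ℕ.≤-reflexive (cong ∣_∣ (≡-sym (p─⊥≡p p))))
∣p∣≤1+∣p-x∣ (inside  ∷ p) (suc x) = s≤s (∣p∣≤1+∣p-x∣ p x)
∣p∣≤1+∣p-x∣ (outside ∷ p) (suc x) = ∣p∣≤1+∣p-x∣ p x

-- Deleting `x` from `p - x` once more would lower the cardinality, although it changes nothing.
x∈p-y⇒x≢y : ∀ {p : Subset n} {x y} → x ∈ p - y → x ≢ y
x∈p-y⇒x≢y {p = p} {x} x∈p-y refl = ℕ.<-irrefl
  (cong ∣_∣ (p─q─q≡p─q p ⁅ x ⁆)) (x∈p⇒∣p-x∣<∣p∣ x∈p-y)

element-outside : ∀ (xs : List (Fin n)) {p} → length xs < ∣ p ∣ →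
                  ∃[ x ] x ∈ p × All (x ≢_) xs
element-outside {n} []   {p} 0<p with nonempty? p
... | yes (x , x∈p) = x , x∈p , []
... | no  p≡∅ = contradiction (trans (cong ∣_∣ (Empty-unique p≡∅)) (∣⊥∣≡0 n)) (ℕ.>⇒≢ 0<p)
element-outside (y ∷ ys) {p} <p
  with element-outside ys {p - y} (s≤s⁻¹ (ℕ.≤-trans <p (∣p∣≤1+∣p-x∣ p y)))
... | x , x∈ , x∉ys = x , p─q⊆p p _ x∈ , x∈p-y⇒x≢y x∈ ∷ x∉ys

neighbours : Graph n → Fin n → Subset n
neighbours H v = Vec.tabulate λ w → does (Adj? H v w)

module _ (H : Graph n) where

  ∈-neighbours⁺ : ∀ {v w} → Adj H v w → w ∈ neighbours H v
  ∈-neighbours⁺ {v} {w} e = lookup⇒[]= w _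
    (trans (lookup∘tabulate (λ w → does (Adj? H v w)) w) (dec-true (Adj? H v w) e))

  ∈-neighbours⁻ : ∀ {v w} → w ∈ neighbours H v → Adj H v w
  ∈-neighbours⁻ {v} {w} w∈ = toWitness′
    (trans (≡-sym (lookup∘tabulate (λ w → does (Adj? H v w)) w)) ([]=⇒lookup w∈))
    where
    toWitness′ : does (Adj? H v w) ≡ true → Adj H v w
    toWitness′ eq with Adj? H v w
    toWitness′ _  | yes e = e

  -- With at most three neighbours, deleting the neighbourhood `N` isolates `v`. Connectivity then
  -- forces every vertex into `N` or onto `v`, which makes at most four vertices, against
  -- `5 ≤ order H`.
  degree≥4 : FourVertexConnected H → ∀ {v} → v ∈ V H → 4 ≤ degree H v
  degree≥4 (5≤H , conn) {v} v∈H with 4 ℕ.≤? degree H v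
  ... | yes 4≤d = 4≤d
  ... | no 4≰d = contradiction
        (ℕ.≤-trans 5≤H (ℕ.≤-trans (∣p∣≤1+∣p-x∣ (V H) v) (s≤s (p⊆q⇒∣p∣≤∣q∣ H-v⊆N))))
        (ℕ.<⇒≱ (s≤s (ℕ.≰⇒> 4≰d)))
    where
    N = neighbours H v
    v∉N : v ∉ N
    v∉N v∈N = irrefl H (∈-neighbours⁻ v∈N)
    connected : Connected (H ∖ N)
    connected = conn N (λ w∈N → end∈V H (sym H (∈-neighbours⁻ w∈N))) (s≤s⁻¹ (ℕ.≰⇒> 4≰d))
    isolated : ∀ {w} → Star (Adj (H ∖ N)) v w → v ≡ w
    isolated ε = refl
    isolated ((e , _ , x∈∁N) ◅ _) = contradiction (∈-neighbours⁺ e) (x∈∁p⇒x∉p x∈∁N)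
    H-v⊆N : V H - v ⊆ N
    H-v⊆N {w} w∈ with w ∈? N
    ... | yes w∈N = w∈N
    ... | no  w∉N = contradiction (≡-sym (isolated (proj₂ connected
            (x∈p∩q⁺ (v∈H , x∉p⇒x∈∁p v∉N)) (x∈p∩q⁺ (p─q⊆p _ _ w∈ , x∉p⇒x∈∁p w∉N)))))
            (x∈p-y⇒x≢y w∈)

module _ {K H : Graph n} (regular : Regular 4 K)
         (connected : ∀ {u v} → u ∈ V K → v ∈ V K → Star (Adj K) u v)
         (H⊑K : H ⊑ K) (conn : FourVertexConnected H) where

  -- A missing edge would make the neighbourhood of `v` in `H` a proper subset of the four
  -- neighbours in `K`, against `degree≥4`.
  adj-reflected : ∀ {v w} → v ∈ V H → Adj K v w → Adj H v w
  adj-reflected {v} {w} v∈H e with Adj? H v w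
  ... | yes e′ = e′
  ... | no ¬e = contradiction (degree≥4 H conn v∈H) (ℕ.<⇒≱ (subst (degree H v <_)
          (regular (proj₁ H⊑K v∈H)) (p⊂q⇒∣p∣<∣q∣
            ((λ x∈ → ∈-neighbours⁺ K (proj₂ H⊑K (∈-neighbours⁻ H x∈)))
            , w , ∈-neighbours⁺ K e , ¬e ∘ ∈-neighbours⁻ H))))

  vertex-reflected : ∀ {v w} → v ∈ V H → Star (Adj K) v w → w ∈ V H
  vertex-reflected v∈H ε        = v∈H
  vertex-reflected v∈H (e ◅ es) =
    vertex-reflected (end∈V H (sym H (adj-reflected v∈H e))) es

  -- `V H` is nonempty and closed under walks of the connected graph `K`; the edges then follow from
  -- `adj-reflected`.
  fourVertexConnected-subgraph-is-whole : K ⊑ H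
  fourVertexConnected-subgraph-is-whole = K⊆H , λ e → adj-reflected (K⊆H (end∈V K e)) e
    where
    seed : Nonempty (V (H ∖ ⊥))
    seed = proj₁ (proj₂ conn ⊥ ⊥⊆ (subst (_≤ 3) (≡-sym (∣⊥∣≡0 n)) z≤n))
    seed∈H = proj₁ (x∈p∩q⁻ (V H) _ (proj₂ seed))
    K⊆H : V K ⊆ V H
    K⊆H v∈K = vertex-reflected seed∈H (connected (proj₁ H⊑K seed∈H) v∈K)

-- Cliques and curvature

clique-size≤2 : ∀ (H : Graph n) → TriangleFree H → ∀ {K} → IsClique H K → ∣ K ∣ ≤ 2
clique-size≤2 H triangleFree {K} (_ , clique) with ∣ K ∣ ℕ.≤? 2
... | yes K≤2 = K≤2
... | no  K≰2 with ℕ.≰⇒> K≰2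
... | K>2 with element-outside [] (ℕ.≤-trans (s≤s z≤n) K>2)
...   | u , u∈K , [] with element-outside (u ∷ []) (ℕ.≤-trans (s≤s (s≤s z≤n)) K>2)
...     | v , v∈K , v≢u ∷ [] with element-outside (u ∷ v ∷ []) K>2
...       | w , w∈K , w≢u ∷ w≢v ∷ [] = contradiction
            (clique u v u∈K v∈K (v≢u ∘ ≡-sym) , clique v w v∈K w∈K (w≢v ∘ ≡-sym) ,
             clique u w u∈K w∈K (w≢u ∘ ≡-sym))
            triangleFree

subsetsOfSize-size : ∀ n k → All (λ K → ∣ K ∣ ≡ k) (subsetsOfSize n k)
subsetsOfSize-size zero    zero    = refl ∷ []
subsetsOfSize-size zero    (suc k) = []
subsetsOfSize-size (suc n) zero    = ∣⊥∣≡0 (suc n) ∷ []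
subsetsOfSize-size (suc n) (suc k) = All.++⁺
  (All.map⁺ (All.map (cong suc) (subsetsOfSize-size n k)))
  (All.map⁺ (subsetsOfSize-size n (suc k)))

cliqueCount≡0 : ∀ (H : Graph n) → TriangleFree H → ∀ i → cliqueCount H (3 + i) ≡ 0
cliqueCount≡0 H triangleFree i = cong length (filter-none (isClique? H)
  (All.map (λ K≡3+i clique → ℕ.<⇒≱ (ℕ.m≤m+n 3 i)
              (subst (_≤ 2) K≡3+i (clique-size≤2 H triangleFree clique)))
    (subsetsOfSize-size _ (3 + i))))

sum-zero : ∀ {n} {f : Fin n → ℚ} → (∀ i → f i ≡ 0ℚ) → sum f ≡ 0ℚ
sum-zero {zero}  f≡0 = refl
sum-zero {suc n} f≡0 = cong₂ _+ℚ_ (f≡0 zero) (sum-zero (f≡0 ∘ suc))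

alternating-sum-truncates : ∀ {n} (N : ℕ → ℕ) → (∀ i → N (3 + i) ≡ 0) →
  sum {3 + n} (λ i → -½ ^ℚ toℕ i *ℚ (ℤ.+ N (toℕ i) / 1)) ≡
  sum {3} (λ i → -½ ^ℚ toℕ i *ℚ (ℤ.+ N (toℕ i) / 1))
alternating-sum-truncates {n} N N≡0 =
  cong (λ s → t 0 +ℚ (t 1 +ℚ (t 2 +ℚ s))) (sum-zero {n} λ i →
    trans (cong (λ k → -½ ^ℚ (3 + toℕ i) *ℚ (ℤ.+ k / 1)) (N≡0 (toℕ i)))
          (ℚ.*-zeroʳ (-½ ^ℚ (3 + toℕ i))))
  where
  t : ℕ → ℚ
  t i = -½ ^ℚ i *ℚ (ℤ.+ N i / 1)

-- Clique counts vanish from size three on. The form `2 + m` of the order exposes the terms of index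
-- 0, 1 and 2.
κ-triangleFree : ∀ (H : Graph n) → TriangleFree H → ∀ {m} → order H ≡ 2 + m →
  κ H ≡ sum {3} (λ i → -½ ^ℚ toℕ i *ℚ (ℤ.+ cliqueCount H (toℕ i) / 1))
κ-triangleFree H triangleFree {m} eq = trans
  (cong (λ v → sum {suc v} (λ i → -½ ^ℚ toℕ i *ℚ (ℤ.+ cliqueCount H (toℕ i) / 1))) eq)
  (alternating-sum-truncates {m} (cliqueCount H) (cliqueCount≡0 H triangleFree))

triangleFree⇒girth≥4 : ∀ (H : Graph n) → TriangleFree H →
  ∀ {m} (c : Fin (suc m) → Fin n) → IsCycle H c → 4 ≤ suc m
triangleFree⇒girth≥4 H triangleFree {1} c (s≤s () , _)
triangleFree⇒girth≥4 H triangleFree {2} c (_ , _ , path , closing) =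
  contradiction (path (# 0) , path (# 1) , sym H closing) triangleFree
triangleFree⇒girth≥4 H triangleFree {suc (suc (suc m))} c _ = ℕ.m≤m+n 4 m

-- Sums over all 0/1 vectors

total : ∀ n → (Subset n → ℕ) → ℕ
total zero    f = f []
total (suc n) f = total n (f ∘ (inside ∷_)) + total n (f ∘ (outside ∷_))

toggle : Fin n → Subset n → Subset n
toggle e c = c [ e ]%= not

total-cong : ∀ n {f g : Subset n → ℕ} → (∀ c → f c ≡ g c) → total n f ≡ total n g
total-cong zero    f≡g = f≡g []
total-cong (suc n) f≡g = cong₂ _+_ (total-cong n (f≡g ∘ _)) (total-cong n (f≡g ∘ _))

total-mono : ∀ n {f g : Subset n → ℕ} → (∀ c → f c ≤ g c) → total n f ≤ total n g
total-mono zero    f≤g = f≤g []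
total-mono (suc n) f≤g = ℕ.+-mono-≤ (total-mono n (f≤g ∘ _)) (total-mono n (f≤g ∘ _))

total-+ : ∀ n (f g : Subset n → ℕ) → total n (λ c → f c + g c) ≡ total n f + total n g
total-+ zero    f g = refl
total-+ (suc n) f g = trans (cong₂ _+_ (total-+ n _ _) (total-+ n _ _))
  (interchange (total n (f ∘ (inside ∷_))) _ _ _)

total-const : ∀ n m → total n (const m) ≡ m * 2 ^ n
total-const zero    m = ≡-sym (ℕ.*-identityʳ m)
total-const (suc n) m = trans (cong₂ _+_ (total-const n m) (total-const n m))
  (solve 2 (λ m p → m :* p :+ m :* p := m :* (con 2 :* p)) refl m (2 ^ n))
  where open +-*-Solver

-- Toggling permutes the vectors; at the first coordinate it swaps the two halves of the sum.
total-toggle : ∀ e (f : Subset n → ℕ) → total n (f ∘ toggle e) ≡ total n f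
total-toggle {suc n} zero    f = ℕ.+-comm (total n (f ∘ (outside ∷_))) _
total-toggle {suc n} (suc e) f = cong₂ _+_ (total-toggle e _) (total-toggle e _)

agree : Bool → Bool → ℕ
agree s t = if s xor t then 0 else 1

agree-not : ∀ s t → agree s t + agree (not s) t ≡ 1
agree-not true  true  = refl
agree-not true  false = refl
agree-not false true  = refl
agree-not false false = refl

agree-refl : ∀ s → agree s s ≡ 1
agree-refl s rewrite Bool.xor-same s = refl

agreements : (Fin n → Bool) → List (Fin n × Fin n) → ℕ
agreements x []             = 0
agreements x ((u , v) ∷ es) = agree (x u) (x v) + agreements x es

-- Pair `c` with `toggle e c`: `u` and `v` agree under exactly one of the two, so each edge
-- contributes half of the `2 ^ n` vectors. The coordinate `e` may vary with the edge.
average-agreements : ∀ (x : Subset n → Fin k → Bool) es →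
  All (λ { (u , v) → ∃[ e ] ∀ c → x (toggle e c) u ≡ not (x c u) × x (toggle e c) v ≡ x c v }) es →
  2 * total n (λ c → agreements (x c) es) ≡ length es * 2 ^ n
average-agreements {n} x [] [] = cong (2 *_) (total-const n 0)
average-agreements {n} x ((u , v) ∷ es) ((e , flips) ∷ flipss) = begin
  2 * total n (λ c → first c + rest c)        ≡⟨ cong (2 *_) (total-+ n first rest) ⟩
  2 * (total n first + total n rest)          ≡⟨ ℕ.*-distribˡ-+ 2 (total n first) _ ⟩
  2 * total n first + 2 * total n rest        ≡⟨ cong₂ _+_ 2*first (average-agreements x es flipss) ⟩
  2 ^ n + length es * 2 ^ n                   ∎
  where
  open ≡-Reasoning
  first rest : Subset n → ℕ
  first c = agree (x c u) (x c v)
  rest  c = agreements (x c) es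
  2*first : 2 * total n first ≡ 2 ^ n
  2*first = begin
    2 * total n first                                 ≡⟨ cong (total n first +_) (ℕ.+-identityʳ _) ⟩
    total n first + total n first                     ≡⟨ cong (total n first +_) (total-toggle e first) ⟨
    total n first + total n (first ∘ toggle e)        ≡⟨ total-+ n _ _ ⟨
    total n (λ c → first c + first (toggle e c))      ≡⟨ total-cong n (λ c →
                                                           let fu , fv = flips c in
                                                           trans (cong₂ (λ s t → first c + agree s t) fu fv)
                                                                 (agree-not (x c u) (x c v))) ⟩
    total n (const 1)                                 ≡⟨ total-const n 1 ⟩
    1 * 2 ^ n                                         ≡⟨ ℕ.*-identityˡ (2 ^ n) ⟩
    2 ^ n                                             ∎

-- A lower bound for every vector is a lower bound for the average, which is half the number of
-- edges.
minimum-agreements : ∀ (x : Subset n → Fin k → Bool) es m →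
  All (λ { (u , v) → ∃[ e ] ∀ c → x (toggle e c) u ≡ not (x c u) × x (toggle e c) v ≡ x c v }) es →
  (∀ c → m ≤ agreements (x c) es) → 2 * m ≤ length es
minimum-agreements {n} x es m flips m≤ = ℕ.*-cancelʳ-≤ (2 * m) (length es) (2 ^ n) {{ℕ.m^n≢0 2 n}}
  (begin
  2 * m * 2 ^ n                              ≡⟨ ℕ.*-assoc 2 m (2 ^ n) ⟩
  2 * (m * 2 ^ n)                            ≡⟨ cong (2 *_) (total-const n m) ⟨
  2 * total n (const m)                      ≤⟨ ℕ.*-monoʳ-≤ 2 (total-mono n m≤) ⟩
  2 * total n (λ c → agreements (x c) es)    ≡⟨ average-agreements x es flips ⟩
  length es * 2 ^ n                          ∎)
  where open ℕ.≤-Reasoning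

-- Gluing labels along edges

-- A coarsening of the partition into fibres of `f` in which glued elements share a class. By
-- `enough`, at most `budget` of the `n` classes are lost.
record Labelling {A : Set} (f : A → Fin n) (Glued : A → A → Set) (budget : ℕ) : Set where
  field
    {labels}   : ℕ
    label      : A → Fin labels
    surjective : ∀ y → ∃[ x ] label x ≡ y
    coarsens   : ∀ {x y} → f x ≡ f y → label x ≡ label y
    glues      : ∀ {x y} → Glued x y → label x ≡ label y
    enough     : n ≤ labels + budget

-- `punchOut` removes the label `f u`, and the class of `u` takes over the label of the class of
-- `v`.
merge : ∀ {A : Set} (f : A → Fin (suc n)) {u v} → f u ≢ f v → A → Fin n
merge f {u} fu≢fv x with f u ≟ f x
... | yes _    = punchOut fu≢fv
... | no fu≢fx = punchOut fu≢fx

module _ {A : Set} (f : A → Fin (suc n)) {u v} (fu≢fv : f u ≢ f v) where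

  merge-cong : ∀ {x y} → f x ≡ f y → merge f fu≢fv x ≡ merge f fu≢fv y
  merge-cong {x} {y} fx≡fy with f u ≟ f x | f u ≟ f y
  ... | yes _    | yes _    = refl
  ... | yes u≡x  | no u≢y   = contradiction (trans u≡x fx≡fy) u≢y
  ... | no u≢x   | yes u≡y  = contradiction (trans u≡y (≡-sym fx≡fy)) u≢x
  ... | no u≢x   | no u≢y   = punchOut-cong (f u) fx≡fy

  merge-glues : merge f fu≢fv u ≡ merge f fu≢fv v
  merge-glues with f u ≟ f u | f u ≟ f v
  ... | yes _    | yes u≡v = contradiction u≡v fu≢fv
  ... | yes _    | no _    = punchOut-cong (f u) refl
  ... | no u≢u   | _       = contradiction refl u≢u

  merge-surjective : (∀ y → ∃[ x ] f x ≡ y) → ∀ y → ∃[ x ] merge f fu≢fv x ≡ y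
  merge-surjective surj y with surj (punchIn (f u) y)
  ... | x , fx≡ = x , go
    where
    go : merge f fu≢fv x ≡ y
    go with f u ≟ f x
    ... | yes u≡x = contradiction (≡-sym (trans u≡x fx≡)) (punchInᵢ≢i (f u) y)
    ... | no  u≢x = trans (punchOut-cong (f u) fx≡) (punchOut-punchIn (f u))

module _ (x : Fin k → Bool) where

  Glue : List (Fin k × Fin k) → Fin k → Fin k → Set
  Glue es u v = (u , v) ∈ˡ es × x u ≡ x v

  -- A bichromatic edge glues nothing. A monochromatic edge unites at most two classes, and it
  -- raises the budget by one.
  labelling : ∀ (f : Fin k → Fin n) → (∀ y → ∃[ x ] f x ≡ y) → ∀ es →
              Labelling f (Glue es) (agreements x es)
  labelling f surj [] = record
    { label = f ; surjective = surj ; coarsens = λ eq → eq ; glues = λ ()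
    ; enough = ℕ.≤-reflexive (≡-sym (ℕ.+-identityʳ _)) }
  labelling f surj ((u , v) ∷ es) = extend (x u Bool.≟ x v) (labelling f surj es)
    where
    extend : Dec (x u ≡ x v) → Labelling f (Glue es) (agreements x es) →
             Labelling f (Glue ((u , v) ∷ es)) (agreements x ((u , v) ∷ es))
    extend (no xu≢xv) L = record
      { label = label ; surjective = surjective ; coarsens = coarsens
      ; glues = λ { (here refl , eq) → contradiction eq xu≢xv ; (there e , eq) → glues (e , eq) }
      ; enough = ℕ.≤-trans enough (ℕ.+-monoʳ-≤ labels (ℕ.m≤n+m _ _)) }
      where open Labelling L
    extend (yes xu≡xv) L with Labelling.label L u ≟ Labelling.label L v
    ... | yes lu≡lv = record
      { label = label ; surjective = surjective ; coarsens = coarsens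
      ; glues = λ { (here refl , eq) → lu≡lv ; (there e , eq) → glues (e , eq) }
      ; enough = ℕ.≤-trans enough (ℕ.+-monoʳ-≤ labels (ℕ.m≤n+m _ _)) }
      where open Labelling L
    ... | no lu≢lv = split L lu≢lv
      where
      split : (L : Labelling f (Glue es) (agreements x es)) →
              Labelling.label L u ≢ Labelling.label L v →
              Labelling f (Glue ((u , v) ∷ es)) (agreements x ((u , v) ∷ es))
      split record { labels = zero ; label = label } _ = case label u of λ ()
      split record { labels = suc m ; label = label ; surjective = surjective ; coarsens = coarsens
                   ; glues = glues ; enough = enough } lu≢lv = record
        { label = merge label lu≢lv
        ; surjective = merge-surjective label lu≢lv surjective
        ; coarsens = merge-cong label lu≢lv ∘ coarsens
        ; glues = λ { (here refl , eq) → merge-glues label lu≢lv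
                    ; (there e , eq) → merge-cong label lu≢lv (glues (e , eq)) }
        -- Here `agree (x u) (x v)` is 1, which pays for the lost label.
        ; enough = ℕ.≤-trans enough (ℕ.≤-reflexive (trans (≡-sym (ℕ.+-suc m _))
            (cong (λ i → m + (i + agreements x es))
              (≡-sym (trans (cong (agree (x u)) (≡-sym xu≡xv)) (agree-refl (x u))))))) }

  two-labels : ∀ {l} (f : Fin k → Fin l) → (∀ y → ∃[ v ] f v ≡ y) →
               (∀ {u v} → x u ≡ x v → f u ≡ f v) → l ≤ 2
  two-labels {zero}        f surj const′ = z≤n
  two-labels {suc zero}    f surj const′ = s≤s z≤n
  two-labels {suc (suc zero)} f surj const′ = s≤s (s≤s z≤n)
  two-labels {suc (suc (suc l))} f surj const′ =
    let u , fu = surj (# 0) ; v , fv = surj (# 1) ; w , fw = surj (# 2)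
        distinct : ∀ {p q : Fin (3 + l)} {s t} → f s ≡ p → f t ≡ q → p ≢ q → x s ≢ x t
        distinct fs ft p≢q xs≡xt = p≢q (trans (≡-sym fs) (trans (const′ xs≡xt) ft))
    in contradiction
         (trans (Bool.¬-not (distinct fu fv λ ())) (≡-sym (Bool.¬-not (distinct fw fv λ ()))))
         (distinct fu fw λ ())

  -- Glue the fibres of `f` along the monochromatic edges in `es`. By `covered`, every monochromatic
  -- edge then stays within one class, so the walks unite each colour into a single class, and at
  -- most two classes remain.
  agreements-lower-bound : ∀ (f : Fin k → Fin n) → (∀ y → ∃[ v ] f v ≡ y) →
    ∀ es {Edge : Fin k → Fin k → Set} →
    (∀ {u v} → Edge u v → x u ≡ x v → f u ≡ f v ⊎ (u , v) ∈ˡ es ⊎ (v , u) ∈ˡ es) →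
    (∀ {u v} → x u ≡ x v → Star (λ p q → Edge p q × x p ≡ x q) u v) →
    n ≤ 2 + agreements x es
  agreements-lower-bound f surj es {Edge} covered walk = ℕ.≤-trans enough
    (ℕ.+-monoˡ-≤ (agreements x es) (two-labels label surjective λ same →
      Star.fold (λ p q → label p ≡ label q) (trans ∘ step) refl (walk same)))
    where
    open Labelling (labelling f surj es)
    step : ∀ {p q} → Edge p q × x p ≡ x q → label p ≡ label q
    step (e , same) with covered e same
    ... | inj₁ fp≡fq       = coarsens fp≡fq
    ... | inj₂ (inj₁ p—q)  = glues (p—q , same)
    ... | inj₂ (inj₂ q—p)  = ≡-sym (glues (q—p , ≡-sym same))

-- Legal systems

-- Graphs that are subgraphs of each other have the same vertices and edges but need not be equal as
-- records, so the data is carried across componentwise.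
LegalSystem-transport : ∀ {H K : Graph n} → H ⊑ K → K ⊑ H → LegalSystem H → LegalSystem K
LegalSystem-transport {H = H} {K} (H⊆K , H⇒K) (K⊆H , K⇒H) L = record
  { move   = move
  ; isMove = λ v∈K → let m⊆H , v∈m , avoids = isMove (K⊆H v∈K) in H⊆K ∘ m⊆H , v∈m , avoids ∘ K⇒H
  ; state  = state
  ; state⊆ = H⊆K ∘ state⊆
  ; legal  = λ x∈ → let T⊆H , within , without = legal (span x∈) in
      H⊆K ∘ T⊆H , connected _ within , connected _ without
  }
  where
  open LegalSystem L
  span : ∀ {x} → Span (V K) move x → Span (V H) move x
  span 0∈         = 0∈
  span (gen v∈K)  = gen (K⊆H v∈K)
  span (add p q)  = add (span p) (span q)
  connected : ∀ T → Connected (H [ T ]) → Connected (K [ T ])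
  connected T ((v , v∈) , walk) = (v , restrict H⊆K v∈) , λ u∈ v∈ →
    Star.map (λ { (e , ends) → H⇒K e , ends }) (walk (restrict K⊆H u∈) (restrict K⊆H v∈))
    where
    restrict : ∀ {P Q : Subset _} → P ⊆ Q → P ∩ T ⊆ Q ∩ T
    restrict {P} P⊆Q v∈ = let v∈P , v∈T = x∈p∩q⁻ P T v∈ in x∈p∩q⁺ (P⊆Q v∈P , v∈T)

-- States are indexed by coefficient vectors, so that averages run over a full cube; linear
-- dependence among the moves merely repeats states.
combination : (Fin k → Subset n) → Subset k → Subset n
combination m []            = ⊥
combination m (inside  ∷ c) = m zero ⊕ combination (m ∘ suc) c
combination m (outside ∷ c) = combination (m ∘ suc) c

combination-∈ : ∀ {B : Subset n} {m} (f : Fin k → Fin n) → (∀ i → f i ∈ B) →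
                ∀ c → Span B m (combination (m ∘ f) c)
combination-∈ f f∈B []            = 0∈
combination-∈ f f∈B (inside  ∷ c) = add (gen (f∈B zero)) (combination-∈ (f ∘ suc) (f∈B ∘ suc) c)
combination-∈ f f∈B (outside ∷ c) = combination-∈ (f ∘ suc) (f∈B ∘ suc) c

xor-cancelˡ : ∀ s t → s xor (s xor t) ≡ t
xor-cancelˡ s t = trans (≡-sym (Bool.xor-assoc s s t)) (cong (_xor t) (Bool.xor-same s))

xor-swap : ∀ s t u → s xor (t xor u) ≡ t xor (s xor u)
xor-swap s t u = trans (≡-sym (Bool.xor-assoc s t u))
  (trans (cong (_xor u) (Bool.xor-comm s t)) (Bool.xor-assoc t s u))

lookup-⊕ : ∀ (p q : Subset n) w → lookup (p ⊕ q) w ≡ lookup p w xor lookup q w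
lookup-⊕ p q w = lookup-zipWith _xor_ w p q

-- Changing the coefficient at `e` adds `m e`; if that summand is already present, the two copies
-- cancel over 𝔽₂.
combination-toggle : ∀ (m : Fin k → Subset n) e c w →
  lookup (combination m (toggle e c)) w ≡ lookup (m e) w xor lookup (combination m c) w
combination-toggle m zero (inside ∷ c) w = ≡-sym
  (trans (cong (lookup (m zero) w xor_) (lookup-⊕ (m zero) _ w)) (xor-cancelˡ (lookup (m zero) w) _))
combination-toggle m zero    (outside ∷ c) w = lookup-⊕ (m zero) _ w
combination-toggle m (suc e) (inside ∷ c) w = begin
  lookup (m zero ⊕ combination (m ∘ suc) (toggle e c)) w
    ≡⟨ lookup-⊕ (m zero) _ w ⟩
  lookup (m zero) w xor lookup (combination (m ∘ suc) (toggle e c)) w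
    ≡⟨ cong (lookup (m zero) w xor_) (combination-toggle (m ∘ suc) e c w) ⟩
  lookup (m zero) w xor (lookup (m (suc e)) w xor lookup (combination (m ∘ suc) c) w)
    ≡⟨ xor-swap (lookup (m zero) w) (lookup (m (suc e)) w) _ ⟩
  lookup (m (suc e)) w xor (lookup (m zero) w xor lookup (combination (m ∘ suc) c) w)
    ≡⟨ cong (lookup (m (suc e)) w xor_) (lookup-⊕ (m zero) _ w) ⟨
  lookup (m (suc e)) w xor lookup (m zero ⊕ combination (m ∘ suc) c) w ∎
  where open ≡-Reasoning
combination-toggle m (suc e) (outside ∷ c) w = combination-toggle (m ∘ suc) e c w

module Colouring {H : Graph n} (L : LegalSystem H) (full : ∀ v → v ∈ V H) where
  open LegalSystem L

  colour : Subset n → Fin n → Bool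
  colour c = lookup (state ⊕ combination move c)

  colour-toggle : ∀ v c w → colour (toggle v c) w ≡ lookup (move v) w xor colour c w
  colour-toggle v c w = begin
    lookup (state ⊕ combination move (toggle v c)) w
      ≡⟨ lookup-⊕ state _ w ⟩
    lookup state w xor lookup (combination move (toggle v c)) w
      ≡⟨ cong (lookup state w xor_) (combination-toggle move v c w) ⟩
    lookup state w xor (lookup (move v) w xor lookup (combination move c) w)
      ≡⟨ xor-swap (lookup state w) (lookup (move v) w) _ ⟩
    lookup (move v) w xor (lookup state w xor lookup (combination move c) w)
      ≡⟨ cong (lookup (move v) w xor_) (lookup-⊕ state _ w) ⟨
    lookup (move v) w xor colour c w ∎
    where open ≡-Reasoning

  toggle-flips : ∀ v c → colour (toggle v c) v ≡ not (colour c v)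
  toggle-flips v c = trans (colour-toggle v c v)
    (cong (_xor colour c v) ([]=⇒lookup (proj₁ (proj₂ (isMove (full v))))))

  toggle-fixes-neighbour : ∀ {v w} → Adj H v w → ∀ c → colour (toggle v c) w ≡ colour c w
  toggle-fixes-neighbour {v} {w} e c = trans (colour-toggle v c w)
    (cong (_xor colour c w) (Bool.¬-not (proj₂ (proj₂ (isMove (full v))) e ∘ lookup⇒[]= w _)))

  MonochromaticEdge : Subset n → Fin n → Fin n → Set
  MonochromaticEdge c u v = Adj H u v × colour c u ≡ colour c v

  -- Colour `true` is the state and colour `false` its complement; legality makes both induced
  -- subgraphs connected.
  monochromatic-walk : ∀ c {u v} → colour c u ≡ colour c v → Star (MonochromaticEdge c) u v
  monochromatic-walk c {u} {v} same = go (colour c u) refl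
    where
    S = state ⊕ combination move c
    isLegal : IsLegal H S
    isLegal = legal (combination-∈ (λ i → i) full c)
    false⇒∁ : ∀ {w} → colour c w ≡ false → w ∈ ∁ S
    false⇒∁ {w} eq = x∉p⇒x∈∁p λ w∈S → case trans (≡-sym eq) ([]=⇒lookup w∈S) of λ ()
    ∁⇒false : ∀ {w} → w ∈ ∁ S → colour c w ≡ false
    ∁⇒false w∈∁S = Bool.¬-not (x∈∁p⇒x∉p w∈∁S ∘ lookup⇒[]= _ S)
    go : ∀ s → colour c u ≡ s → Star (MonochromaticEdge c) u v
    go true  eq = Star.map (λ { (e , p , q) → e , trans ([]=⇒lookup p) (≡-sym ([]=⇒lookup q)) })
      (proj₂ (proj₁ (proj₂ isLegal))
        (x∈p∩q⁺ (full u , lookup⇒[]= u S eq)) (x∈p∩q⁺ (full v , lookup⇒[]= v S (trans (≡-sym same) eq))))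
    go false eq = Star.map (λ { (e , p , q) → e , trans (∁⇒false p) (≡-sym (∁⇒false q)) })
      (proj₂ (proj₂ (proj₂ isLegal))
        (x∈p∩q⁺ (full u , false⇒∁ eq)) (x∈p∩q⁺ (full v , false⇒∁ (trans (≡-sym same) eq))))

  module _ (a : Fin 3 → Fin n) (distinct : ∀ {k l} → k ≢ l → a k ≢ a l)
           (twins : ∀ k l {w} → Adj H (a k) w → Adj H (a l) w) (s : Bool) where

    Surrounded : Subset n → Set
    Surrounded c = ∀ k {w} → Adj H (a k) w → colour c w ≡ s

    -- Twins share all their neighbours, and a move at one twin changes none of these. The colours
    -- of the twins can thus be varied while they stay surrounded.
    toggle-surrounded : ∀ l c → Surrounded c → Surrounded (toggle (a l) c)
    toggle-surrounded l c surr k e =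
      trans (toggle-fixes-neighbour (twins k l e) c) (surr k e)

    -- No monochromatic edge leaves `a k`, so connectedness of its colour class makes it the only
    -- vertex of colour `not s`.
    lone : ∀ c → Surrounded c → ∀ {k w} → colour c (a k) ≡ not s → a k ≢ w → colour c w ≡ s
    lone c surr {k} {w} k≡¬s ak≢w with colour c w Bool.≟ s
    ... | yes w≡s = w≡s
    ... | no  w≢s = contradiction
            (stuck (monochromatic-walk c (trans k≡¬s (≡-sym (Bool.¬-not w≢s))))) ak≢w
      where
      stuck : ∀ {w} → Star (MonochromaticEdge c) (a k) w → a k ≡ w
      stuck ε = refl
      stuck ((e , same) ◅ _) =
        contradiction (trans (≡-sym (surr k e)) (trans (≡-sym same) k≡¬s)) (Bool.not-¬ refl)

    turn : ∀ l c → colour c (a l) ≡ s → colour (toggle (a l) c) (a l) ≡ not s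
    turn l c eq = trans (toggle-flips (a l) c) (cong not eq)

    -- If only a 0 has colour not s, then toggling a 2 must leave a 1 with colour s both now and
    -- after a toggle at a 1, although a 1 has colour s in the first case and not s in the second.
    twin-not-isolated : ∀ c → Surrounded c → colour c (a (# 0)) ≢ not s
    twin-not-isolated c surr a₀ = contradiction (trans (≡-sym still) turned) (Bool.not-¬ refl)
      where
      open ≡-Reasoning
      c₁ = toggle (a (# 1)) c
      surr₁ = toggle-surrounded (# 1) c surr
      a₁ : colour c (a (# 1)) ≡ s
      a₁ = lone c surr a₀ (distinct λ ())
      a₁′ : colour c₁ (a (# 1)) ≡ not s
      a₁′ = turn (# 1) c a₁
      bit = lookup (move (a (# 2))) (a (# 1))
      after-toggle : ∀ c → Surrounded c → colour c (a (# 2)) ≡ s →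
                     bit xor colour c (a (# 1)) ≡ s
      after-toggle c surr a₂ = trans (≡-sym (colour-toggle (a (# 2)) c (a (# 1))))
        (lone (toggle (a (# 2)) c) (toggle-surrounded (# 2) c surr) (turn (# 2) c a₂) (distinct λ ()))
      still : bit xor s ≡ s
      still = trans (cong (bit xor_) (≡-sym a₁))
        (after-toggle c surr (lone c surr a₀ (distinct λ ())))
      turned : bit xor s ≡ not s
      turned = begin
        bit xor s                           ≡⟨ Bool.not-involutive _ ⟨
        not (not (bit xor s))               ≡⟨ cong not (Bool.not-distribʳ-xor bit s) ⟩
        not (bit xor not s)                 ≡⟨ cong (λ t → not (bit xor t)) a₁′ ⟨
        not (bit xor colour c₁ (a (# 1)))   ≡⟨ cong not (after-toggle c₁ surr₁
                                                 (lone c₁ surr₁ a₁′ (distinct λ ()))) ⟩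
        not s                               ∎

    -- A toggle at `a 0`, if necessary, gives it the colour `not s`, which `twin-not-isolated`
    -- excludes.
    not-surrounded : ∀ c → ¬ Surrounded c
    not-surrounded c surr with colour c (a (# 0)) Bool.≟ s
    ... | yes eq = twin-not-isolated (toggle (a (# 0)) c) (toggle-surrounded (# 0) c surr)
            (turn (# 0) c eq)
    ... | no neq = twin-not-isolated c surr (Bool.¬-not neq)

-- The graph consists of four copies of K₃,₄, the i-th one with sides {a i k} and {b i j}, of
-- four vertices o j, and of a centre.  The fourth edge at b i j goes to o j if j ≠ i and to the
-- centre if j = i; opposite vertices among the o j are adjacent.
data Site : Set where
  a      : Fin 4 → Fin 3 → Site
  b      : Fin 4 → Fin 4 → Site
  o      : Fin 4 → Site
  centre : Site

-- The first 32 labels form four runs of eight: the `i`-th run holds the three `a i k`, the four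
-- `b i j` and `o i`. The last label is the centre.
site : Fin 33 → Site
site v = [ (λ w → let i , t = remQuot {4} 8 w in
                  [ a i , [ b i , const (o i) ]′ ∘ splitAt 4 ]′ (splitAt 3 t))
         , const centre ]′ (splitAt 32 v)

vertex : Site → Fin 33
vertex (a i k) = combine i (k ↑ˡ 5) ↑ˡ 1
vertex (b i j) = combine i (3 ↑ʳ (j ↑ˡ 1)) ↑ˡ 1
vertex (o i)   = combine {4} {8} i (# 7) ↑ˡ 1
vertex centre  = # 32

next opposite : Fin 4 → Fin 4
next zero                   = # 1
next (suc zero)             = # 2
next (suc (suc zero))       = # 3
next (suc (suc (suc zero))) = # 0
opposite = next ∘ next

_==_ : Fin 4 → Fin 4 → Bool
i == j = does (i ≟ j)

joined : Site → Site → Bool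
joined (a i _) (b i′ _) = i == i′
joined (b i j) (o k)    = not (i == j) ∧ (j == k)
joined (b i j) centre   = i == j
joined (o j)   (o k)    = k == opposite j
joined _       _        = false

_~_ : Fin 33 → Fin 33 → Set
u ~ v = T (joined (site u) (site v) ∨ joined (site v) (site u))

_~?_ : ∀ u v → Dec (u ~ v)
u ~? v = Bool.T? _

~-irrefl : ∀ v → ¬ (v ~ v)
~-irrefl = from-yes (all? λ v → ¬? (v ~? v))

G : Graph 33
V      G = ⊤
Adj    G = _~_
Adj?   G = _~?_
sym    G {u} {v} = subst T (Bool.∨-comm (joined (site u) (site v)) _)
irrefl G {v} = ~-irrefl v
end∈V  G _ = ∈⊤

-- Four-vertex-connectivity of the graph

-- At b i i, which is not adjacent to o i, the path to o i detours through the centre and the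
-- next copy.
exit : Fin 4 → Fin 4 → List Site
exit i j = if i == j
  then centre ∷ b (next i) (next i) ∷ a (next i) (# 0) ∷ b (next i) i ∷ o i ∷ []
  else o j ∷ []

-- Each nonempty fan has one path to each of the four vertices `o j`.
fan : Site → List (List Site)
fan (a i k) = tabulate λ j → b i j ∷ exit i j
fan (b i j) = exit i j ∷ tabulate λ k → a i k ∷ b i (punchIn j k) ∷ exit i (punchIn j k)
-- The `o j` are themselves targets and get no paths.
fan (o j)   = []
fan centre  = tabulate λ i → b i i ∷ a i (# 0) ∷ b i (next i) ∷ o (next i) ∷ []

-- Paths from `o j` to neighbours of `o k`, with `o k` itself left off to keep them disjoint. Two
-- tracks cross the copies other than `j` and `k`. Copy `j` has no edge to `o j` and copy `k` none
-- to `o k`. If `j` and `k` are opposite, these two copies combine into one track through the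
-- centre, and the empty track is the edge between `o j` and `o k`; otherwise each of them yields a
-- track through another `o i`.
tracks : Fin 4 → Fin 4 → List (List Site)
tracks j k = if k == opposite j
  then [] ∷ bridge (next j) ∷ bridge (next k)
       ∷ (b k j ∷ a k (# 0) ∷ b k k ∷ centre ∷ b j j ∷ a j (# 0) ∷ b j k ∷ []) ∷ []
  else bridge (opposite j) ∷ bridge (opposite k)
       ∷ (b k j ∷ a k (# 0) ∷ b k (opposite k) ∷ o (opposite k) ∷ [])
       ∷ (o (opposite j) ∷ b j (opposite j) ∷ a j (# 0) ∷ b j k ∷ []) ∷ []
  where
  bridge : Fin 4 → List Site
  bridge i = b i j ∷ a i (# 0) ∷ b i k ∷ []

-- Three deletions leave one of the four hubs, every remaining vertex reaches a remaining hub, and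
-- remaining hubs reach each other. Checking 29 fans and 12 families of tracks thus replaces a
-- search over all deleted sets.
hub : Fin 4 → Fin 33
hub j = vertex (o j)

IsHub : Fin 33 → Set
IsHub v = ∃[ j ] v ≡ hub j

isHub? : ∀ v → Dec (IsHub v)
isHub? v = any? λ j → v ≟ hub j

vertices : List (List Site) → List (List (Fin 33))
vertices = List.map (List.map vertex)

-- Facts established by exhaustive search are abstract: unfolding them would repeat the search.
abstract
  fan-valid : ∀ v → ¬ IsHub v → IsFan G IsHub v (vertices (fan (site v)))
  fan-valid = from-yes (all? λ v → ¬? (isHub? v) →-dec isFan? G isHub? v (vertices (fan (site v))))

  tracks-valid : ∀ j k → j ≢ k → IsFan G (_~ hub k) (hub j) (vertices (tracks j k))
  tracks-valid = from-yes (all? λ j → all? λ k → ¬? (j ≟ k) →-dec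
    isFan? G (_~? hub k) (hub j) (vertices (tracks j k)))

hubs : List (List (Fin 33))
hubs = tabulate λ j → hub j ∷ []

hubs-disjoint : PairwiseDisjoint hubs
hubs-disjoint = from-yes (pairwiseDisjoint? hubs)

module _ {U : Subset 33} (U≤3 : ∣ U ∣ ≤ 3) where

  surviving-hub : ∃[ j ] hub j ∉ U
  surviving-hub with missed-list {ps = hubs} hubs-disjoint (s≤s U≤3)
  ... | p , p∈ , p∉U with ∈-tabulate⁻ {f = λ j → hub j ∷ []} p∈
  ...   | j , refl = j , All.head p∉U

  walk-to-hub : ∀ v → v ∉ U → ∃[ j ] hub j ∉ U × Star (Adj (G ∖ U)) v (hub j)
  walk-to-hub v v∉U with isHub? v
  ... | yes (j , refl) = j , v∉U , ε
  ... | no ¬hub with fan-survives G IsHub _ (fan-valid v ¬hub) U≤3 v∉U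
  ...   | _ , (j , refl) , j∉U , walk = j , j∉U , walk

  walk-between-hubs : ∀ j k → hub j ∉ U → hub k ∉ U → Star (Adj (G ∖ U)) (hub j) (hub k)
  walk-between-hubs j k j∉U k∉U with j ≟ k
  ... | yes refl = ε
  ... | no j≢k with fan-survives G (_~ hub k) _ (tracks-valid j k j≢k) U≤3 j∉U
  ...   | t , t~k , t∉U , walk = walk ◅◅ (t~k , x∉p⇒x∈∁p t∉U , x∉p⇒x∈∁p k∉U) ◅ ε

  G∖U-connected : Connected (G ∖ U)
  G∖U-connected =
      (let j , j∉U = surviving-hub in hub j , x∈p∩q⁺ (∈⊤ , x∉p⇒x∈∁p j∉U))
    , λ {u} {v} u∈ v∈ →
      let j , j∉U , u⇝j = walk-to-hub u (avoids u∈)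
          k , k∉U , v⇝k = walk-to-hub v (avoids v∈)
      in u⇝j ◅◅ walk-between-hubs j k j∉U k∉U ◅◅ reverse-walk (G ∖ U) v⇝k
    where
    avoids : ∀ {v} → v ∈ V (G ∖ U) → v ∉ U
    avoids v∈ = x∈∁p⇒x∉p (proj₂ (x∈p∩q⁻ ⊤ (∁ U) v∈))

G-fourVertexConnected : FourVertexConnected G
G-fourVertexConnected = ℕ.m≤m+n 5 28 , λ U _ U≤3 → G∖U-connected U≤3

-- Cells, links and the nonexistence of a legal system

block : Site → Fin 4 ⊎ Fin 5
block (a i _) = inj₁ i
block (b i _) = inj₁ i
block (o j)   = inj₂ (suc j)
block centre  = inj₂ zero

links : List (Fin 33 × Fin 33)
links = concatMap (λ i → tabulate λ j → vertex (b i j) , vertex (if i == j then centre else o j))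
                  (allFin 4)
     -- Besides the 16 edges leaving the copies there are two among the `o j`; `0` and `1` represent
     -- the two opposite pairs.
     ++ List.map (λ j → hub j , hub (opposite j)) (# 0 ∷ # 1 ∷ [])

block-vertex-b : ∀ i j → block (site (vertex (b i j))) ≡ inj₁ i
block-vertex-b = from-yes (all? λ i → all? λ j → Sum.≡-dec _≟_ _≟_ (block (site (vertex (b i j)))) (inj₁ i))

module _ where
  open DecMembership (≡-dec (_≟_ {33}) (_≟_ {33})) using () renaming (_∈?_ to _∈ˡ?_)
  abstract
    links-adjacent : All (λ { (u , v) → u ~ v }) links
    links-adjacent = from-yes (All.all? (λ { (u , v) → u ~? v }) links)

    block-or-link : ∀ u v → u ~ v →
      block (site u) ≡ block (site v) ⊎ (u , v) ∈ˡ links ⊎ (v , u) ∈ˡ links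
    block-or-link = from-yes (all? λ u → all? λ v → (u ~? v) →-dec
      (Sum.≡-dec _≟_ _≟_ (block (site u)) (block (site v))
        ⊎-dec ((u , v) ∈ˡ? links) ⊎-dec ((v , u) ∈ˡ? links)))

    side : ∀ i → (∀ k l → k ≢ l → vertex (a i k) ≢ vertex (a i l)) ×
                 (∀ k w → vertex (a i k) ~ w → ∃[ j ] w ≡ vertex (b i j)) ×
                 (∀ k j → vertex (a i k) ~ vertex (b i j))
    side = from-yes (all? λ i →
      (all? λ k → all? λ l → ¬? (k ≟ l) →-dec ¬? (vertex (a i k) ≟ vertex (a i l))) ×-dec
      (all? λ k → all? λ w → (vertex (a i k) ~? w) →-dec any? (λ j → w ≟ vertex (b i j))) ×-dec
      (all? λ k → all? λ j → vertex (a i k) ~? vertex (b i j)))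

-- Cells 0 to 3 are the `true` parts of the four copies, cells 4 to 7 their `false` parts, cell 8 is
-- the centre and cells 9 to 12 are the `o j`.
cell′ : Bool → Fin 4 ⊎ Fin 5 → Fin 13
cell′ s (inj₁ i) = if s then i ↑ˡ 9 else 4 ↑ʳ (i ↑ˡ 5)
cell′ s (inj₂ j) = 8 ↑ʳ j

cell : (Fin 33 → Bool) → Fin 33 → Fin 13
cell x v = cell′ (x v) (block (site v))

ordinary : Fin 5 → Site
ordinary zero    = centre
ordinary (suc j) = o j

block-ordinary : ∀ j → block (site (vertex (ordinary j))) ≡ inj₂ j
block-ordinary = from-yes (all? λ j → Sum.≡-dec _≟_ _≟_ (block (site (vertex (ordinary j)))) (inj₂ j))

module _ (x : Fin 33 → Bool) (bichromatic : ∀ i s → ∃[ j ] x (vertex (b i j)) ≡ s) where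

  cell-of-block : ∀ i s → ∃[ v ] cell x v ≡ cell′ s (inj₁ i)
  cell-of-block i s = let j , eq = bichromatic i s in
    vertex (b i j) , cong₂ cell′ eq (block-vertex-b i j)

  cell-surjective : ∀ y → ∃[ v ] cell x v ≡ y
  cell-surjective y with splitAt 4 y in eq
  ... | inj₁ i = let v , eq′ = cell-of-block i true in v , trans eq′ (splitAt⁻¹-↑ˡ eq)
  ... | inj₂ z with splitAt 4 z in eqz
  ...   | inj₁ i = let v , eq′ = cell-of-block i false in
            v , trans eq′ (trans (cong (4 ↑ʳ_) (splitAt⁻¹-↑ˡ eqz)) (splitAt⁻¹-↑ʳ eq))
  ...   | inj₂ j = vertex (ordinary j) , trans (cong (cell′ (x (vertex (ordinary j)))) (block-ordinary j))
            (trans (cong (4 ↑ʳ_) (splitAt⁻¹-↑ʳ eqz)) (splitAt⁻¹-↑ʳ eq))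

links-agreements : ∀ x → (∀ i s → ∃[ j ] x (vertex (b i j)) ≡ s) →
  (∀ {u v} → x u ≡ x v → Star (λ p q → p ~ q × x p ≡ x q) u v) → 11 ≤ agreements x links
-- The general bound reads `13 ≤ 2 + agreements x links`, for 13 cells and two colours.
links-agreements x bichromatic walk = ℕ.+-cancelˡ-≤ 2 11 _
  (agreements-lower-bound x (cell x) (cell-surjective x bichromatic) links
    (λ {u} {v} e same → Sum.map₁ (cong₂ cell′ same) (block-or-link u v e)) walk)

no-legal-system : ¬ LegalSystem G
no-legal-system L = contradiction
  (minimum-agreements colour links 11
    -- The coordinate toggled for an edge is its first end `u`: the move there flips `u` and fixes
    -- its neighbour `v`.
    (All.map (λ { {u , v} e → u , λ c → toggle-flips u c , toggle-fixes-neighbour e c }) links-adjacent)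
    (λ c → links-agreements (colour c) (bichromatic c) (monochromatic-walk c)))
  (λ 22≤18 → contradiction 22≤18 (from-no (22 ℕ.≤? 18)))
  where
  open Colouring L (λ v → ∈⊤)
  bichromatic : ∀ c i s → ∃[ j ] colour c (vertex (b i j)) ≡ s
  bichromatic c i s with any? (λ j → colour c (vertex (b i j)) Bool.≟ s)
  ... | yes found = found
  -- If colour `s` is missing from the `b i j`, the twins `a i k` are surrounded by colour `not s`.
  ... | no none = contradiction
          (λ { k {w} e → let j , w≡ = proj₁ (proj₂ (side i)) k w e in trans (cong (colour c) w≡)
               (Bool.¬-not (λ eq → none (j , eq))) })
          (not-surrounded (λ k → vertex (a i k)) (proj₁ (side i) _ _)
             (λ k l {w} e → let j , w≡ = proj₁ (proj₂ (side i)) k w e in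
                subst (vertex (a i l) ~_) (≡-sym w≡) (proj₂ (proj₂ (side i)) l j))
             (not s) c)

-- Regularity, girth and curvature of the graph

abstract
  G-size : size G ≡ 66
  G-size = refl

  G-vertexCliques : cliqueCount G 1 ≡ 33
  G-vertexCliques = refl

  G-edgeCliques : cliqueCount G 2 ≡ 66
  G-edgeCliques = refl

  G-degree : ∀ v → degree G v ≡ 4
  G-degree = from-yes (all? λ v → degree G v ℕ.≟ 4)

  -- The hypothesis `u ~ v` precedes the quantifier over `w`, so that the search tries third
  -- vertices only for adjacent pairs.
  G-noTriangle : ∀ u v → u ~ v → ∀ w → v ~ w → ¬ (u ~ w)
  G-noTriangle = from-yes (all? λ u → all? λ v → (u ~? v) →-dec
    all? λ w → (v ~? w) →-dec ¬? (u ~? w))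

G-regular : Regular 4 G
G-regular {v} _ = G-degree v

G-triangleFree : TriangleFree G
G-triangleFree {u} {v} {w} (u~v , v~w , u~w) = G-noTriangle u v u~v w v~w u~w

square : Fin 4 → Fin 33
square = vertex ∘ lookup (a (# 0) (# 0) ∷ b (# 0) (# 0) ∷ a (# 0) (# 1) ∷ b (# 0) (# 1) ∷ [])

G-girth : Girth G 4
G-girth = (3 , refl , square , s≤s (s≤s z≤n) , (λ {i} {j} → injective i j) , path , _)
        , triangleFree⇒girth≥4 G (λ {u} {v} {w} → G-triangleFree {u} {v} {w})
  where
  injective : ∀ i j → square i ≡ square j → i ≡ j
  injective = from-yes (all? λ i → all? λ j → (square i ≟ square j) →-dec (i ≟ j))
  path : ∀ i → square (inject₁ i) ~ square (suc i)
  path = from-yes (all? λ i → square (inject₁ i) ~? square (suc i))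

κ₂≡1 : κ₂ G ≡ 1ℚ
κ₂≡1 = cong (λ e → 1ℚ -ℚ ℤ.+ 33 / 2 +ℚ ℤ.+ e / 4) G-size

κ≡1 : κ G ≡ 1ℚ
κ≡1 = trans (κ-triangleFree G (λ {u} {v} {w} → G-triangleFree {u} {v} {w}) refl)
  (evaluate (cliqueCount G) refl G-vertexCliques G-edgeCliques)
  where
  -- With `N` a variable, only the three given values enter the computation 1 - 33/2 + 66/4 = 1.
  evaluate : ∀ (N : ℕ → ℕ) → N 0 ≡ 1 → N 1 ≡ 33 → N 2 ≡ 66 →
             sum {3} (λ i → -½ ^ℚ toℕ i *ℚ (ℤ.+ N (toℕ i) / 1)) ≡ 1ℚ
  evaluate N N₀ N₁ N₂ rewrite N₀ | N₁ | N₂ = refl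

G-connected : ∀ {u v} → u ∈ ⊤ → v ∈ ⊤ → Star _~_ u v
-- Plain connectedness is the case of no deleted vertices.
G-connected _ _ = Star.map proj₁ (proj₂ (G∖U-connected {⊥} z≤n)
  (x∈p∩q⁺ (∈⊤ , ∈⊤)) (x∈p∩q⁺ (∈⊤ , ∈⊤)))

theorem1p1 : ∃[ G ] order {33} G ≡ 33 × size G ≡ 66
    × (Regular 4 G × TriangleFree G × Girth G 4 × FourVertexConnected G)
    × (κ₂ G ≡ 1ℚ × κ G ≡ 1ℚ)
    × (∀ (H : Graph 33) → H ⊑ G → FourVertexConnected H → ¬ LegalSystem H)
theorem1p1 = G , refl , G-size
  , (G-regular , (λ {u} {v} {w} → G-triangleFree {u} {v} {w}) , G-girth , G-fourVertexConnected)
  , (κ₂≡1 , κ≡1)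
  , λ H H⊑G conn L → no-legal-system (LegalSystem-transport H⊑G
      (fourVertexConnected-subgraph-is-whole {K = G} {H} G-regular G-connected H⊑G conn) L)
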